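{- For all integers $n\geq 1$, $$H_1(n,n)=\frac13\left(4^{n-1}-1\right).$$
   Context: For positive integers $r,n,k$, let $H_r(n,k)$ be the number of $n\times k$ arrays of integers (rows indexed $i=1,\dots,n$, columns indexed $j=1,\dots,k$) which obey the following rules: (1) the entry in position $(1,1)$ is $0$, and the entry in position $(n,k)$ is $\max(n,k)-r-1$; (2) the entry in position $(i,j)$ must equal or be one more than each of the entries in positions $(i-1,j)$, $(i,j-1)$, and $(i-1,j-1)$ (whenever those positions exist in the array); (3) the entry in position $(i,j)$ must be within $r$ of $\max(i,j)-1$, i.e. differ from it by at most $r$ in absolute value. (If the rules are contradictory, as for $n=k=1$, the count is $0$.) -}

module Defs where

open import Algebra.Bundles using (AbelianGroup)
import Algebra.Properties.Group as Group
open import Data.Fin.Base using (Fin; zero; suc; toℕ)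
open import Data.Fin.Properties using (all?)
open import Data.Integer.Base as ℤ using (ℤ; +_; -[1+_]; 0ℤ; 1ℤ; ∣_∣)
open import Data.Integer.Properties as ℤₚ using ()
open import Data.List.Base as List
  using (List; []; _∷_; _++_; length; filter; upTo; cartesianProductWith)
open import Data.List.Membership.Propositional using (_∈_)
open import Data.List.Membership.Propositional.Properties
  using (∈-map⁺; ∈-map⁻; ∈-++⁺ˡ; ∈-++⁺ʳ; ∈-upTo⁺; ∈-filter⁺; ∈-filter⁻;
         ∈-cartesianProductWith⁺)
open import Data.List.Relation.Binary.Disjoint.Propositional using (Disjoint)
open import Data.List.Relation.Unary.All as All using ()
open import Data.List.Relation.Unary.AllPairs using ([]; _∷_)
open import Data.List.Relation.Unary.Any using (here)
open import Data.List.Relation.Unary.Unique.Propositional using (Unique)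
import Data.List.Relation.Unary.Unique.Propositional.Properties as Uniqueₚ
open import Data.Nat.Base using (ℕ; zero; suc; _⊔_; _≤_; s≤s)
open import Data.Nat.Properties as ℕₚ using ()
open import Data.Product.Base using (_,_; proj₂)
open import Data.Sum.Base using (_⊎_)
open import Data.Vec.Base using (Vec; []; _∷_; lookup; tabulate)
open import Data.Vec.Properties using (∷-injective)
open import Function.Base using (_∘_)
open import Relation.Nullary.Decidable using (Dec; map′; _×-dec_; _⊎-dec_; _→-dec_)
open import Relation.Binary.PropositionalEquality
  using (_≡_; refl; cong; subst; module ≡-Reasoning)

Array : ℕ → ℕ → Set
Array n k = Vec (Vec ℤ k) n

entry : ∀ {n k} → Array n k → Fin n → Fin k → ℤ
entry a i j = lookup (lookup a i) j

-- Rows and columns are numbered from 1, whereas toℕ counts from 0.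
pos : ∀ {n} → Fin n → ℕ
pos i = suc (toℕ i)

EqualOrOneMore : ℤ → ℤ → Set
EqualOrOneMore x y = x ≡ y ⊎ x ≡ y ℤ.+ 1ℤ

Within : ℕ → ℤ → ℤ → Set
Within r c x = ∣ x ℤ.- c ∣ ≤ r

corner : ℕ → ℕ → ℕ → ℤ
corner r n k = + (n ⊔ k) ℤ.- + r ℤ.- 1ℤ

centre : ℕ → ℕ → ℤ
centre i j = + (i ⊔ j) ℤ.- 1ℤ

record Obeys (r n k : ℕ) (a : Array n k) : Set where
  field
    first     : ∀ i j → pos i ≡ 1 → pos j ≡ 1 → entry a i j ≡ 0ℤ
    last      : ∀ i j → pos i ≡ n → pos j ≡ k → entry a i j ≡ corner r n k
    above     : ∀ i i′ j → pos i ≡ suc (pos i′) →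
                EqualOrOneMore (entry a i j) (entry a i′ j)
    left      : ∀ i j j′ → pos j ≡ suc (pos j′) →
                EqualOrOneMore (entry a i j) (entry a i j′)
    aboveLeft : ∀ i i′ j j′ → pos i ≡ suc (pos i′) → pos j ≡ suc (pos j′) →
                EqualOrOneMore (entry a i j) (entry a i′ j′)
    within    : ∀ i j → Within r (centre (pos i) (pos j)) (entry a i j)

equalOrOneMore? : ∀ x y → Dec (EqualOrOneMore x y)
equalOrOneMore? x y = x ℤₚ.≟ y ⊎-dec x ℤₚ.≟ y ℤ.+ 1ℤ

obeys? : ∀ r n k (a : Array n k) → Dec (Obeys r n k a)
obeys? r n k a = map′
  (λ (p , q , s , t , u , v) → record
    { first = p ; last = q ; above = s ; left = t ; aboveLeft = u ; within = v })
  (λ o → let open Obeys o in first , last , above , left , aboveLeft , within)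
  (      (all? λ i → all? λ j → pos i ℕₚ.≟ 1 →-dec (pos j ℕₚ.≟ 1 →-dec
           entry a i j ℤₚ.≟ 0ℤ))
   ×-dec (all? λ i → all? λ j → pos i ℕₚ.≟ n →-dec (pos j ℕₚ.≟ k →-dec
           entry a i j ℤₚ.≟ corner r n k))
   ×-dec (all? λ i → all? λ i′ → all? λ j → pos i ℕₚ.≟ suc (pos i′) →-dec
           equalOrOneMore? (entry a i j) (entry a i′ j))
   ×-dec (all? λ i → all? λ j → all? λ j′ → pos j ℕₚ.≟ suc (pos j′) →-dec
           equalOrOneMore? (entry a i j) (entry a i j′))
   ×-dec (all? λ i → all? λ i′ → all? λ j → all? λ j′ →
           pos i ℕₚ.≟ suc (pos i′) →-dec (pos j ℕₚ.≟ suc (pos j′) →-dec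
           equalOrOneMore? (entry a i j) (entry a i′ j′)))
   ×-dec (all? λ i → all? λ j →
           ∣ entry a i j ℤ.- centre (pos i) (pos j) ∣ ℕₚ.≤? r))

interval : ℕ → ℤ → List ℤ
interval r c = List.map (λ d → c ℤ.+ d) (List.map +_ (upTo (suc r)) ++ List.map -[1+_] (upTo r))

choices : ∀ {A : Set} {n} → Vec (List A) n → List (Vec A n)
choices []         = [] ∷ []
choices (xs ∷ xss) = cartesianProductWith _∷_ xs (choices xss)

-- The `within` rule leaves finitely many candidates for each entry.
candidates : ∀ r n k → List (Array n k)
candidates r n k =
  choices (tabulate λ i → choices (tabulate λ j → interval r (centre (pos i) (pos j))))

obeying : ∀ r n k → List (Array n k)
obeying r n k = filter (obeys? r n k) (candidates r n k)

-- By obeying-complete, obeying-sound and obeying-unique below, this is the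
-- number of all integer arrays that obey the rules.
H : ℕ → ℕ → ℕ → ℕ
H r n k = length (obeying r n k)

------------------------------------------------------------------------

∈-interval : ∀ r c x → Within r c x → x ∈ interval r c
∈-interval r c x w = subst (_∈ interval r c) c+[x-c]≡x (∈-map⁺ (λ d → c ℤ.+ d) (offset (x ℤ.- c) w))
  where
  offset : ∀ d → ∣ d ∣ ≤ r → d ∈ List.map +_ (upTo (suc r)) ++ List.map -[1+_] (upTo r)
  offset (+ m)    m≤r = ∈-++⁺ˡ (∈-map⁺ +_ (∈-upTo⁺ (s≤s m≤r)))
  offset -[1+ m ] m<r = ∈-++⁺ʳ (List.map +_ (upTo (suc r))) (∈-map⁺ -[1+_] (∈-upTo⁺ m<r))

  open ≡-Reasoning
  c+[x-c]≡x : c ℤ.+ (x ℤ.- c) ≡ x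
  c+[x-c]≡x = begin
    c ℤ.+ (x ℤ.- c)       ≡⟨ ℤₚ.+-comm c (x ℤ.- c) ⟩
    (x ℤ.- c) ℤ.+ c       ≡⟨ ℤₚ.+-assoc x (ℤ.- c) c ⟩
    x ℤ.+ (ℤ.- c ℤ.+ c)   ≡⟨ cong (λ d → x ℤ.+ d) (ℤₚ.+-inverseˡ c) ⟩
    x ℤ.+ 0ℤ              ≡⟨ ℤₚ.+-identityʳ x ⟩
    x                     ∎

interval-unique : ∀ r c → Unique (interval r c)
interval-unique r c = Uniqueₚ.map⁺ (∙-cancelˡ c _ _)
  (Uniqueₚ.++⁺ (Uniqueₚ.map⁺ ℤₚ.+-injective (Uniqueₚ.upTo⁺ (suc r)))
               (Uniqueₚ.map⁺ ℤₚ.-[1+-injective (Uniqueₚ.upTo⁺ r))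
               disjoint)
  where
  open Group (AbelianGroup.group ℤₚ.+-0-abelianGroup) using (∙-cancelˡ)

  disjoint : Disjoint (List.map +_ (upTo (suc r))) (List.map -[1+_] (upTo r))
  disjoint (p , q) with ∈-map⁻ +_ p | ∈-map⁻ -[1+_] q
  ... | _ , _ , refl | _ , _ , ()

∈-choices : ∀ {A : Set} {n} (f : Fin n → List A) (v : Vec A n) →
            (∀ i → lookup v i ∈ f i) → v ∈ choices (tabulate f)
∈-choices f []      _ = here refl
∈-choices f (x ∷ v) h = ∈-cartesianProductWith⁺ _∷_ (h zero) (∈-choices (f ∘ suc) v (h ∘ suc))

choices-unique : ∀ {A : Set} {n} (f : Fin n → List A) →
                 (∀ i → Unique (f i)) → Unique (choices (tabulate f))
choices-unique {n = zero}  f _ = All.[] ∷ []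
choices-unique {n = suc n} f u =
  Uniqueₚ.cartesianProductWith⁺ _∷_ ∷-injective (u zero) (choices-unique (f ∘ suc) (u ∘ suc))

obeying-complete : ∀ r n k (a : Array n k) → Obeys r n k a → a ∈ obeying r n k
obeying-complete r n k a o = ∈-filter⁺ (obeys? r n k)
  (∈-choices _ a λ i → ∈-choices _ (lookup a i) λ j →
    ∈-interval r (centre (pos i) (pos j)) (entry a i j) (Obeys.within o i j))
  o

obeying-sound : ∀ r n k (a : Array n k) → a ∈ obeying r n k → Obeys r n k a
obeying-sound r n k a = proj₂ ∘ ∈-filter⁻ (obeys? r n k) {xs = candidates r n k}

obeying-unique : ∀ r n k → Unique (obeying r n k)
obeying-unique r n k = Uniqueₚ.filter⁺ (obeys? r n k)
  (choices-unique _ λ i → choices-unique _ λ j → interval-unique r (centre (pos i) (pos j)))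

{-# OPTIONS --safe #-}

-- Subtracting the entries from max(i,j) − 1 leaves a 0/1 array that is 0 at
-- (1,1) and 1 at (n,n).  Without its first row and column this array is either
-- all ones, and then row 1 and column 1 are forced, or again of the same kind.
-- In the second case row 1 of the original array is row 2 either kept in place
-- or decreased by 1 and moved one place to the left; these two rows are distinct
-- because row 2 has exactly one repeated entry.  The same holds for column 1, so
-- H₁(n + 1, n + 1) = 1 + 4 H₁(n, n), starting from H₁(1, 1) = 0.

module Submission where

open import Data.Bool.Base using (Bool; true; false; if_then_else_)
open import Data.Empty using (⊥-elim)
open import Data.Fin.Base using (Fin; toℕ; fromℕ<)
open import Data.Fin.Properties using (toℕ-fromℕ<; toℕ-injective; toℕ≤pred[n])
open import Data.Integer.Base using (+_)
open import Data.Integer.Base as ℤ using (ℤ; ∣_∣)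
open import Data.Integer.Properties as ℤₚ using (+-injective)
import Data.Integer.Tactic.RingSolver as ℤ-Solver
open import Data.List.Base as List using (List; []; _∷_; length; cartesianProductWith)
open import Data.List.Membership.Propositional using (_∈_)
open import Data.List.Membership.Propositional.Properties
  using (∈-map⁺; ∈-map⁻; ∈-cartesianProductWith⁺; ∈-cartesianProductWith⁻)
open import Data.List.Membership.Propositional.Properties.WithK using (unique∧set⇒bag)
open import Data.List.Properties using (length-map; length-++)
open import Data.List.Relation.Binary.BagAndSetEquality using (∼bag⇒↭)
open import Data.List.Relation.Binary.Permutation.Propositional.Properties using (↭-length)
open import Data.List.Relation.Unary.All as All using ()
open import Data.List.Relation.Unary.AllPairs using ([]; _∷_)
open import Data.List.Relation.Unary.Any using (here; there)
open import Data.List.Relation.Unary.Unique.Propositional using (Unique)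
import Data.List.Relation.Unary.Unique.Propositional.Properties as Uniqueₚ
open import Data.Nat.Base using (ℕ; _^_; _∸_; _≥_)
open import Data.Nat.Base as ℕ
  using (zero; suc; pred; _+_; _⊔_; _≤_; _<_; z≤n; s≤s; s≤s⁻¹; z<s; _≤′_; ≤′-refl; ≤′-step)
open import Data.Nat.Properties
  using (≤-refl; ≤-trans; ≤-reflexive; ≤-antisym; ≤-total; <⇒≤; <-trans; <-cmp; ≤⇒≤′;
         n≤1+n; 1+n≢n; m<n⇒m<1+n; m≤n⇒m≤1+n; suc-injective; pred[n]≤n; pred-mono-≤;
         +-comm; +-monoʳ-≤; m≤n+m∸n; m≤n+o⇒m∸n≤o; m⊓n≤n; m≤n⇒m⊓n≡m;
         ⊔-comm; ⊔-idem; ⊔-identityʳ; ⊔-lub; m≤m⊔n; m≤n⊔m)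
import Data.Nat.Tactic.RingSolver as ℕ-Solver
open import Data.Product.Base using (∃; _×_; _,_; proj₁; proj₂)
open import Data.Rational.Base using (_/_; _*_; _-_; 1ℚ)
open import Data.Rational.Base as ℚ using (toℚᵘ; fromℚᵘ)
import Data.Rational.Properties as ℚₚ
open import Data.Rational.Unnormalised.Base as ℚᵘ using (mkℚᵘ; *≡*; 1ℚᵘ)
import Data.Rational.Unnormalised.Properties as ℚᵘₚ
open import Data.Sum.Base using (_⊎_; inj₁; inj₂)
open import Data.Vec.Base using (Vec; lookup; tabulate)
open import Data.Vec.Properties using (lookup∘tabulate; tabulate∘lookup; tabulate-cong)
open import Function.Base using (flip; _∘_)
open import Function.Bundles using (mk⇔)
open import Relation.Binary.Definitions using (tri<; tri≈; tri>)
open import Relation.Binary.PropositionalEquality using (_≡_)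
open import Relation.Binary.PropositionalEquality
  using (_≢_; refl; sym; trans; cong; cong₂; subst; subst₂; module ≡-Reasoning)
open import Defs

-- Grids: the rules for `r = 1` over natural numbers, with indices from 0

Next : ℕ → ℕ → Set
Next x y = x ≡ y ⊎ x ≡ suc y

Next-suc : ∀ {x y} → Next x y → Next (suc x) (suc y)
Next-suc (inj₁ e) = inj₁ (cong suc e)
Next-suc (inj₂ e) = inj₂ (cong suc e)

Next-pred : ∀ {x y} → Next x y → Next (pred x) (pred y)
Next-pred             (inj₁ refl) = inj₁ refl
Next-pred {y = zero}  (inj₂ refl) = inj₁ refl
Next-pred {y = suc _} (inj₂ refl) = inj₂ refl

Next⇒≥ : ∀ {x y} → Next x y → y ≤ x
Next⇒≥ (inj₁ refl) = ≤-refl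
Next⇒≥ (inj₂ refl) = n≤1+n _

Next⇒≤ : ∀ {x y} → Next x y → x ≤ suc y
Next⇒≤ (inj₁ refl) = n≤1+n _
Next⇒≤ (inj₂ refl) = ≤-refl

-- The successor in `final` replaces the subtraction in the corner value; for `N = 0` it makes the
-- record contradictory, as the 1 × 1 case should be.
record Grid (N : ℕ) (f : ℕ → ℕ → ℕ) : Set where
  field
    origin : f 0 0 ≡ 0
    final  : suc (f N N) ≡ N
    above  : ∀ {i j} → i < N → j ≤ N → Next (f (suc i) j) (f i j)
    left   : ∀ {i j} → i ≤ N → j < N → Next (f i (suc j)) (f i j)
    diag   : ∀ {i j} → i < N → j < N → Next (f (suc i) (suc j)) (f i j)
    lower  : ∀ {i j} → i ≤ N → j ≤ N → i ⊔ j ≤ suc (f i j)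

-- Lets each argument about rows serve for columns as well.
transpose : ∀ {N f} → Grid N f → Grid N (flip f)
transpose {f = f} G = record
  { origin = origin
  ; final  = final
  ; above  = λ i<N j≤N → left j≤N i<N
  ; left   = λ i≤N j<N → above j<N i≤N
  ; diag   = λ i<N j<N → diag j<N i<N
  ; lower  = λ {i} {j} i≤N j≤N → subst (_≤ suc (f j i)) (⊔-comm j i) (lower j≤N i≤N)
  }
  where open Grid G

column-mono : ∀ {N f i i′ j} → Grid N f → i ≤ i′ → i′ ≤ N → j ≤ N → f i j ≤ f i′ j
column-mono {f = f} {i} {j = j} G i≤i′ = go (≤⇒≤′ i≤i′)
  where
  go : ∀ {i′} → i ≤′ i′ → i′ ≤ _ → j ≤ _ → f i j ≤ f i′ j
  go ≤′-refl      _    _   = ≤-refl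
  go (≤′-step le) i′<N j≤N = ≤-trans (go le (<⇒≤ i′<N) j≤N) (Next⇒≥ (Grid.above G i′<N j≤N))

mono : ∀ {N f i i′ j j′} → Grid N f → i ≤ i′ → i′ ≤ N → j ≤ j′ → j′ ≤ N → f i j ≤ f i′ j′
mono G i≤i′ i′≤N j≤j′ j′≤N =
  ≤-trans (column-mono G i≤i′ i′≤N (≤-trans j≤j′ j′≤N)) (column-mono (transpose G) j≤j′ j′≤N i′≤N)

-- Codes and the arrays they describe

-- The two bits tell, for the first row and the first column, whether it copies
-- its neighbour (true) or is the neighbour moved by one place (false).
data Code : ℕ → Set where
  flat : ∀ {N} → Code (suc N)
  grow : ∀ {N} → Bool × Bool → Code N → Code (suc N)

-- Index `j` stands for column `j + 1` of the larger array, where the neighbouring entry is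
-- `suc (r j)`. In the last column, `false` reads `r` one place past the inner array, so `value` is
-- defined for all natural indices.
edge : Bool → (ℕ → ℕ) → ℕ → ℕ
edge p r j = if p then suc (r j) else r (suc j)

-- Shifting both indices by 1 raises `i ⊔ j` by 1, hence the `suc` on the inner array.
border : (ℕ → ℕ) → (ℕ → ℕ) → (ℕ → ℕ → ℕ) → ℕ → ℕ → ℕ
border r s g zero    zero    = 0
border r s g zero    (suc j) = r j
border r s g (suc i) zero    = s i
border r s g (suc i) (suc j) = suc (g i j)

value : ∀ {N} → Code N → ℕ → ℕ → ℕ
value flat             i j = pred (i ⊔ j)
value (grow (p , q) c) = border (edge p (value c 0)) (edge q (flip (value c) 0)) (value c)

-- Arrays of codes obey the rules

module _ {r : ℕ → ℕ} (step : ∀ j → Next (r (suc j)) (r j)) where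

  edge-step : ∀ p j → Next (edge p r (suc j)) (edge p r j)
  edge-step true  j = Next-suc (step j)
  edge-step false j = step (suc j)

  -- For `false`, a repeat in `r` makes the inner entry one larger than the edge, and a rise in `r`
  -- makes the two equal.
  edge-beside : ∀ p j → Next (suc (r j)) (edge p r j)
  edge-beside true  j = inj₁ refl
  edge-beside false j with step j
  ... | inj₁ e = inj₂ (cong suc (sym e))
  ... | inj₂ e = inj₁ (sym e)

  edge-diag : ∀ p j → Next (suc (r (suc j))) (edge p r j)
  edge-diag true  j = Next-suc (step j)
  edge-diag false j = inj₂ refl

  edge-start : r 0 ≡ 0 → ∀ p → Next (edge p r 0) 0
  edge-start e true  = inj₂ (cong suc e)
  edge-start e false = subst (Next (r 1)) e (step 0)

edge-upper : ∀ {r} → (∀ j → r j ≤ j) → ∀ p j → edge p r j ≤ suc j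
edge-upper u true  j = s≤s (u j)
edge-upper u false j = u (suc j)

edge-lower : ∀ {r} → (∀ j → j ≤ suc (r j)) → ∀ p j → j ≤ edge p r j
edge-lower l true  j = l j
edge-lower l false j = s≤s⁻¹ (l (suc j))

⊔-above : ∀ i j → Next (suc i ⊔ j) (i ⊔ j)
⊔-above zero    zero    = inj₂ refl
⊔-above zero    (suc j) = inj₁ refl
⊔-above (suc i) zero    = inj₂ refl
⊔-above (suc i) (suc j) = Next-suc (⊔-above i j)

value-origin : ∀ {N} (c : Code N) → value c 0 0 ≡ 0
value-origin flat       = refl
value-origin (grow _ c) = refl

value-corner : ∀ {N} (c : Code N) → suc (value c N N) ≡ N
value-corner (flat {N}) = cong suc (⊔-idem N)
value-corner (grow _ c) = cong suc (value-corner c)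

-- Proved together with `value-left`: comparing the new first row with the row below it uses
-- horizontal steps of the inner array, and the new first column uses vertical ones.
value-above : ∀ {N} (c : Code N) i j → Next (value c (suc i) j) (value c i j)
value-left  : ∀ {N} (c : Code N) i j → Next (value c i (suc j)) (value c i j)

value-above flat             i       j       = Next-pred (⊔-above i j)
value-above (grow (p , q) c) zero    zero    = edge-start (λ i → value-above c i 0) (value-origin c) q
value-above (grow (p , q) c) zero    (suc j) = edge-beside (value-left c 0) p j
value-above (grow (p , q) c) (suc i) zero    = edge-step (λ i → value-above c i 0) q i
value-above (grow (p , q) c) (suc i) (suc j) = Next-suc (value-above c i j)

value-left flat             i       j       =
  subst₂ Next (cong pred (⊔-comm (suc j) i)) (cong pred (⊔-comm j i)) (Next-pred (⊔-above j i))
value-left (grow (p , q) c) zero    zero    = edge-start (value-left c 0) (value-origin c) p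
value-left (grow (p , q) c) zero    (suc j) = edge-step (value-left c 0) p j
value-left (grow (p , q) c) (suc i) zero    = edge-beside (λ i → value-above c i 0) q i
value-left (grow (p , q) c) (suc i) (suc j) = Next-suc (value-left c i j)

value-diag : ∀ {N} (c : Code N) i j → Next (value c (suc i) (suc j)) (value c i j)
value-diag flat             i       j       = Next-pred (inj₂ refl)
value-diag (grow (p , q) c) zero    zero    = inj₂ (cong suc (value-origin c))
value-diag (grow (p , q) c) zero    (suc j) = edge-diag (value-left c 0) p j
value-diag (grow (p , q) c) (suc i) zero    = edge-diag (λ i → value-above c i 0) q i
value-diag (grow (p , q) c) (suc i) (suc j) = Next-suc (value-diag c i j)

-- With `value-lower`, each entry is `i ⊔ j` or one less, which yields `within` for `r = 1`.
value-upper : ∀ {N} (c : Code N) i j → value c i j ≤ i ⊔ j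
value-upper flat             i       j       = pred[n]≤n
value-upper (grow (p , q) c) zero    zero    = z≤n
value-upper (grow (p , q) c) zero    (suc j) = edge-upper (value-upper c 0) p j
value-upper (grow (p , q) c) (suc i) zero    =
  edge-upper (λ i → subst (value c i 0 ≤_) (⊔-identityʳ i) (value-upper c i 0)) q i
value-upper (grow (p , q) c) (suc i) (suc j) = s≤s (value-upper c i j)

value-lower : ∀ {N} (c : Code N) i j → i ⊔ j ≤ suc (value c i j)
value-lower flat             i       j       = suc[pred] (i ⊔ j)
  where
  suc[pred] : ∀ m → m ≤ suc (pred m)
  suc[pred] zero    = z≤n
  suc[pred] (suc m) = ≤-refl
value-lower (grow (p , q) c) zero    zero    = z≤n
value-lower (grow (p , q) c) zero    (suc j) = s≤s (edge-lower (value-lower c 0) p j)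
value-lower (grow (p , q) c) (suc i) zero    =
  s≤s (edge-lower (λ i → subst (_≤ suc (value c i 0)) (⊔-identityʳ i) (value-lower c i 0)) q i)
value-lower (grow (p , q) c) (suc i) (suc j) = s≤s (value-lower c i j)

-- The repeated entry of the first row and column

-- The values 0, 1, …, k, k, k + 1, …
record Stalls (k : ℕ) (r : ℕ → ℕ) : Set where
  field
    before : ∀ {j} → j ≤ k → r j ≡ j
    after  : ∀ {j} → k < j → suc (r j) ≡ j

module _ {k r} (S : Stalls k r) where
  open Stalls S

  -- Away from the repeat both bits give the same edge; only index `k` tells them apart.
  edge-before : ∀ p {j} → j < k → edge p r j ≡ suc j
  edge-before true  j<k = cong suc (before (<⇒≤ j<k))
  edge-before false j<k = before j<k

  edge-after : ∀ p {j} → k < j → edge p r j ≡ j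
  edge-after true  k<j = after k<j
  edge-after false k<j = suc-injective (after (m<n⇒m<1+n k<j))

  edge-at-true : edge true r k ≡ suc k
  edge-at-true = cong suc (before ≤-refl)

  edge-at-false : edge false r k ≡ k
  edge-at-false = suc-injective (after ≤-refl)

  edge-injective : ∀ p p′ → edge p r k ≡ edge p′ r k → p ≡ p′
  edge-injective true  true  _ = refl
  edge-injective false false _ = refl
  edge-injective true  false e = ⊥-elim (1+n≢n (trans (sym edge-at-true) (trans e edge-at-false)))
  edge-injective false true  e = ⊥-elim (1+n≢n (trans (sym edge-at-true) (trans (sym e) edge-at-false)))

  -- For `true`, `s` is `r` raised by 1 and moved right behind a 0, so the repeat moves to `k + 1`.
  -- For `false`, `s` is `r` itself, since `r 0` is 0.
  Stalls-edge : ∀ p {s} → s 0 ≡ 0 → (∀ j → s (suc j) ≡ edge p r j) →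
                Stalls (if p then suc k else k) s
  Stalls-edge true  s₀ s₊ = record
    { before = λ { {zero} _ → s₀
                 ; {suc j} (s≤s j≤k) → trans (s₊ j) (cong suc (before j≤k)) }
    ; after  = λ { {suc j} (s≤s k<j) → cong suc (trans (s₊ j) (edge-after true k<j)) }
    }
  Stalls-edge false s₀ s₊ = record
    { before = λ { {zero} _ → s₀
                 ; {suc j} j<k → trans (s₊ j) (before j<k) }
    ; after  = λ { {suc j} k<1+j → cong suc (trans (s₊ j) (suc-injective (after k<1+j))) }
    }

  -- Row 1 bounds row 0 from above. The matching lower bound comes from the diagonal rule for
  -- `j < k` and from `lower` for `j > k`. Only `j = k` is left free, and its two possible values
  -- correspond to the two bits.
  edge-complete : ∀ {N f} → Grid (suc N) f → k < N → (∀ {j} → j ≤ N → f 1 (suc j) ≡ suc (r j)) →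
                  ∃ λ p → ∀ {j} → j ≤ N → f 0 (suc j) ≡ edge p r j
  edge-complete {N} {f} G k<N f₁ = choose (above z<s (s≤s (<⇒≤ k<N)))
    where
    open Grid G

    f₀≤ : ∀ {j} → j ≤ N → f 0 (suc j) ≤ suc (r j)
    f₀≤ {j} j≤N = subst (f 0 (suc j) ≤_) (f₁ j≤N) (Next⇒≥ (above z<s (s≤s j≤N)))

    f₀-before : ∀ {j} → j < k → f 0 (suc j) ≡ suc j
    f₀-before {j} j<k = ≤-antisym
      (subst (λ x → _ ≤ suc x) (before (<⇒≤ j<k)) (f₀≤ (<⇒≤ j<N)))
      (s≤s⁻¹ (subst (_≤ suc (f 0 (suc j)))
        (trans (f₁ j<N) (cong suc (before j<k))) (Next⇒≤ (diag z<s (s≤s j<N)))))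
      where
      j<N : j < N
      j<N = <-trans j<k k<N

    f₀-after : ∀ {j} → k < j → j ≤ N → f 0 (suc j) ≡ j
    f₀-after {j} k<j j≤N = ≤-antisym
      (subst (f 0 (suc j) ≤_) (after k<j) (f₀≤ j≤N))
      (s≤s⁻¹ (lower z≤n (s≤s j≤N)))

    extend : ∀ p → f 0 (suc k) ≡ edge p r k → ∀ {j} → j ≤ N → f 0 (suc j) ≡ edge p r j
    extend p e {j} j≤N with <-cmp j k
    ... | tri< j<k _ _    = trans (f₀-before j<k) (sym (edge-before p j<k))
    ... | tri≈ _ refl _   = e
    ... | tri> _ _ k<j    = trans (f₀-after k<j j≤N) (sym (edge-after p k<j))

    choose : Next (f 1 (suc k)) (f 0 (suc k)) → ∃ λ p → ∀ {j} → j ≤ N → f 0 (suc j) ≡ edge p r j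
    choose (inj₁ e) = true  , extend true (trans (sym e) (f₁ (<⇒≤ k<N)))
    choose (inj₂ e) = false , extend false
      (trans (suc-injective (trans (sym e) (f₁ (<⇒≤ k<N)))) (trans (before ≤-refl) (sym edge-at-false)))

if-suc-< : ∀ p {k N} → k < N → (if p then suc k else k) < suc N
if-suc-< true  k<N = s≤s k<N
if-suc-< false k<N = m<n⇒m<1+n k<N

-- The bound `k < N` keeps both equal entries, at `k` and `k + 1`, inside the array.
row-stalls : ∀ {N} (c : Code N) → ∃ λ k → k < N × Stalls k (value c 0)
row-stalls flat = 0 , z<s , record
  { before = λ { z≤n → refl }
  ; after  = λ { (s≤s _) → refl } }
row-stalls (grow (p , q) c) with row-stalls c
... | k , k<N , S = _ , if-suc-< p k<N , Stalls-edge S p refl (λ _ → refl)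

column-stalls : ∀ {N} (c : Code N) → ∃ λ k → k < N × Stalls k (flip (value c) 0)
column-stalls flat = 0 , z<s , record
  { before = λ { z≤n → refl }
  ; after  = λ { (s≤s _) → refl } }
column-stalls (grow (p , q) c) with column-stalls c
... | k , k<N , S = _ , if-suc-< q k<N , Stalls-edge S q refl (λ _ → refl)

-- Distinct codes give distinct arrays

-- Entry (1,1), counted from 0, separates `flat` from `grow`; the inner code follows by induction,
-- and each bit is read off where the inner first row or column repeats.
value-injective : ∀ {N} (c c′ : Code N) →
                  (∀ {i j} → i ≤ N → j ≤ N → value c i j ≡ value c′ i j) → c ≡ c′
value-injective flat       flat       _ = refl
value-injective flat       (grow _ _) e with () ← e {1} {1} (s≤s z≤n) (s≤s z≤n)
value-injective (grow _ _) flat       e with () ← e {1} {1} (s≤s z≤n) (s≤s z≤n)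
value-injective (grow (p , q) c) (grow (p′ , q′) c′) e
  with refl ← value-injective c c′ (λ i≤N j≤N → suc-injective (e (s≤s i≤N) (s≤s j≤N)))
  with k , k<N , S ← row-stalls c | l , l<N , T ← column-stalls c
  = cong₂ (λ p q → grow (p , q) c)
      (edge-injective S p p′ (e z≤n (s≤s (<⇒≤ k<N))))
      (edge-injective T q q′ (e (s≤s (<⇒≤ l<N)) z≤n))

-- Every grid comes from a code

-- Diagonal steps add at most 1, so `f m m` is at most `pred m`. Monotonicity carries this to all
-- positions with maximum `m`, and `lower` is the opposite bound.
flat-complete : ∀ {N f} → Grid (suc N) f → f 1 1 ≡ 0 →
                ∀ {i j} → i ≤ suc N → j ≤ suc N → f i j ≡ pred (i ⊔ j)
flat-complete {N} {f} G f₁₁ {i} {j} i≤N j≤N = ≤-antisym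
  (≤-trans (mono G (m≤m⊔n i j) m≤N (m≤n⊔m i j) m≤N) (diagonal (i ⊔ j) m≤N))
  (pred-mono-≤ (lower i≤N j≤N))
  where
  open Grid G
  m≤N : i ⊔ j ≤ suc N
  m≤N = ⊔-lub i≤N j≤N

  diagonal : ∀ m → m ≤ suc N → f m m ≤ pred m
  diagonal zero          _   = ≤-reflexive origin
  diagonal (suc zero)    _   = ≤-reflexive f₁₁
  diagonal (suc (suc m)) m≤N = ≤-trans (Next⇒≤ (diag m≤N m≤N)) (s≤s (diagonal (suc m) (<⇒≤ m≤N)))

-- Monotonicity makes every inner entry at least 1, so the truncated `pred` in `inner` loses
-- nothing.
inner-suc : ∀ {N f} → Grid (suc N) f → f 1 1 ≡ 1 →
            ∀ {i j} → i ≤ N → j ≤ N → f (suc i) (suc j) ≡ suc (pred (f (suc i) (suc j)))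
inner-suc {f = f} G f₁₁ {i} {j} i≤N j≤N = positive
  (subst (_≤ f (suc i) (suc j)) f₁₁ (mono G (s≤s z≤n) (s≤s i≤N) (s≤s z≤n) (s≤s j≤N)))
  where
  positive : ∀ {x} → 1 ≤ x → x ≡ suc (pred x)
  positive (s≤s _) = refl

inner : ∀ {N f} → Grid (suc N) f → f 1 1 ≡ 1 → Grid N (λ i j → pred (f (suc i) (suc j)))
inner {f = f} G f₁₁ = record
  { origin = cong pred f₁₁
  ; final  = trans (sym (inner-suc G f₁₁ ≤-refl ≤-refl)) (suc-injective final)
  ; above  = λ i<N j≤N → Next-pred (above (s≤s i<N) (s≤s j≤N))
  ; left   = λ i≤N j<N → Next-pred (left (s≤s i≤N) (s≤s j<N))
  ; diag   = λ i<N j<N → Next-pred (diag (s≤s i<N) (s≤s j<N))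
  ; lower  = λ i≤N j≤N → s≤s⁻¹ (subst (λ x → _ ≤ suc x) (inner-suc G f₁₁ i≤N j≤N)
                                 (lower (s≤s i≤N) (s≤s j≤N)))
  }
  where open Grid G

value-complete : ∀ {N f} → Grid N f →
                 ∃ λ (c : Code N) → ∀ {i j} → i ≤ N → j ≤ N → f i j ≡ value c i j
value-complete {zero}  G with () ← Grid.final G
-- The diagonal step from the origin decides: staying at 0 is the flat case, rising to 1 leaves a
-- smaller grid inside.
value-complete {suc N} {f} G with Grid.diag G {0} {0} z<s z<s
... | inj₁ e = flat , flat-complete G (trans e (Grid.origin G))
... | inj₂ e = peel
  where
  f₁₁ : f 1 1 ≡ 1
  f₁₁ = trans e (cong suc (Grid.origin G))

  peel : ∃ λ (c : Code (suc N)) → ∀ {i j} → i ≤ suc N → j ≤ suc N → f i j ≡ value c i j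
  peel with value-complete (inner G f₁₁)
  ... | c , inner≡ with row-stalls c | column-stalls c
  ... | k , k<N , S | l , l<N , T = grow (proj₁ row , proj₁ column) c , agree
    where
    f₊ : ∀ {i j} → i ≤ N → j ≤ N → f (suc i) (suc j) ≡ suc (value c i j)
    f₊ i≤N j≤N = trans (inner-suc G f₁₁ i≤N j≤N) (cong suc (inner≡ i≤N j≤N))

    row : ∃ λ p → ∀ {j} → j ≤ N → f 0 (suc j) ≡ edge p (value c 0) j
    row = edge-complete S G k<N (f₊ z≤n)

    column : ∃ λ q → ∀ {i} → i ≤ N → f (suc i) 0 ≡ edge q (flip (value c) 0) i
    column = edge-complete T (transpose G) l<N (λ i≤N → f₊ i≤N z≤n)

    agree : ∀ {i j} → i ≤ suc N → j ≤ suc N → f i j ≡ value (grow (proj₁ row , proj₁ column) c) i j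
    agree {zero}  {zero}  _         _         = Grid.origin G
    agree {zero}  {suc j} _         (s≤s j≤N) = proj₂ row j≤N
    agree {suc i} {zero}  (s≤s i≤N) _         = proj₂ column i≤N
    agree {suc i} {suc j} (s≤s i≤N) (s≤s j≤N) = f₊ i≤N j≤N

-- Translation between natural and integer rules

Next⇒EqualOrOneMore : ∀ {x y} → Next x y → EqualOrOneMore (+ x) (+ y)
Next⇒EqualOrOneMore         (inj₁ e) = inj₁ (cong +_ e)
Next⇒EqualOrOneMore {y = y} (inj₂ e) = inj₂ (cong +_ (trans e (+-comm 1 y)))

EqualOrOneMore⇒Next : ∀ {x y} → EqualOrOneMore (+ x) (+ y) → Next x y
EqualOrOneMore⇒Next         (inj₁ e) = inj₁ (+-injective e)
EqualOrOneMore⇒Next {y = y} (inj₂ e) = inj₂ (trans (+-injective e) (+-comm y 1))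

∣x-m∣≡m∸x : ∀ {x m} → x ≤ m → ∣ + x ℤ.- + m ∣ ≡ m ∸ x
∣x-m∣≡m∸x {x} {m} x≤m = trans (cong ∣_∣ (ℤₚ.m-n≡m⊖n x m)) (ℤₚ.∣⊖∣-≤ x≤m)

near⇒Within : ∀ {x m} → x ≤ m → m ≤ suc x → Within 1 (+ m) (+ x)
near⇒Within {x} {m} x≤m m≤1+x = subst (_≤ 1) (sym (∣x-m∣≡m∸x x≤m))
  (m≤n+o⇒m∸n≤o m x (subst (m ≤_) (+-comm 1 x) m≤1+x))

Within⇒lower : ∀ {x m} → Within 1 (+ m) (+ x) → m ≤ suc x
Within⇒lower {x} {m} w with ≤-total x m
... | inj₁ x≤m = subst (m ≤_) (+-comm x 1)
  (≤-trans (m≤n+m∸n m x) (+-monoʳ-≤ x (subst (_≤ 1) (∣x-m∣≡m∸x x≤m) w)))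
... | inj₂ m≤x = m≤n⇒m≤1+n m≤x

corner-suc : ∀ x → corner 1 (suc (suc x)) (suc (suc x)) ≡ + x
corner-suc x = cong +_ (⊔-idem x)

corner-injective : ∀ {N x} → + x ≡ corner 1 (suc N) (suc N) → suc x ≡ N
-- For `N = 0` the corner is -1, which is no `+ x`.
corner-injective {suc N} e = cong suc (+-injective (trans e (corner-suc N)))

array-ext : ∀ {n k} {a b : Array n k} → (∀ i j → entry a i j ≡ entry b i j) → a ≡ b
array-ext e = vec-ext (λ i → vec-ext (e i))
  where
  vec-ext : ∀ {A : Set} {n} {u v : Vec A n} → (∀ i → lookup u i ≡ lookup v i) → u ≡ v
  vec-ext {u = u} {v} e =
    trans (sym (tabulate∘lookup u)) (trans (tabulate-cong e) (tabulate∘lookup v))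

-- Integer arrays from codes

toArray : ∀ {N} → Code N → Array (suc N) (suc N)
toArray c = tabulate λ i → tabulate λ j → + value c (toℕ i) (toℕ j)

entry-toArray : ∀ {N} (c : Code N) i j → entry (toArray c) i j ≡ + value c (toℕ i) (toℕ j)
entry-toArray {N} c i j =
  trans (cong (flip lookup j) (lookup∘tabulate (tabulate ∘ entries) i)) (lookup∘tabulate (entries i) j)
  where
  entries : Fin (suc N) → Fin (suc N) → ℤ
  entries i j = + value c (toℕ i) (toℕ j)

toArray-obeys : ∀ {N} (c : Code N) → Obeys 1 (suc N) (suc N) (toArray c)
toArray-obeys {N} c = record
  { first     = λ i j i₀ j₀ → entry≡ i j i₀ j₀ (cong +_ (value-origin c))
  ; last      = λ i j iₙ jₙ → entry≡ i j iₙ jₙ (corner≡ (value-corner c))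
  ; above     = λ i i′ j e → steps i j i′ j
                  (subst (λ m → Next (value c m _) _) (sym (suc-injective e)) (value-above c _ _))
  ; left      = λ i j j′ e → steps i j i j′
                  (subst (λ m → Next (value c _ m) _) (sym (suc-injective e)) (value-left c _ _))
  ; aboveLeft = λ i i′ j j′ e e′ → steps i j i′ j′
                  (subst₂ (λ l m → Next (value c l m) _) (sym (suc-injective e)) (sym (suc-injective e′))
                    (value-diag c _ _))
  -- The -1 in `centre` cancels the shift in `pos`, so the centre computes to `+ (toℕ i ⊔ toℕ j)`.
  ; within    = λ i j → subst (Within 1 _) (sym (entry-toArray c i j))
                  (near⇒Within (value-upper c (toℕ i) (toℕ j)) (value-lower c (toℕ i) (toℕ j)))
  }
  where
  entry≡ : ∀ i j {k l z} → pos i ≡ suc k → pos j ≡ suc l → + value c k l ≡ z → entry (toArray c) i j ≡ z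
  entry≡ i j eᵢ eⱼ e =
    trans (entry-toArray c i j) (trans (cong₂ (λ k l → + value c k l) (suc-injective eᵢ) (suc-injective eⱼ)) e)

  corner≡ : ∀ {x} → suc x ≡ N → + x ≡ corner 1 (suc N) (suc N)
  corner≡ refl = sym (corner-suc _)

  steps : ∀ i j i′ j′ → Next (value c (toℕ i) (toℕ j)) (value c (toℕ i′) (toℕ j′)) →
          EqualOrOneMore (entry (toArray c) i j) (entry (toArray c) i′ j′)
  steps i j i′ j′ s = subst₂ EqualOrOneMore (sym (entry-toArray c i j)) (sym (entry-toArray c i′ j′))
                        (Next⇒EqualOrOneMore s)

toArray-injective : ∀ {N} {c c′ : Code N} → toArray c ≡ toArray c′ → c ≡ c′
toArray-injective {N} {c} {c′} e = value-injective c c′ λ i≤N j≤N →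
  subst₂ (λ i j → value c i j ≡ value c′ i j) (toℕ-fromℕ< (s≤s i≤N)) (toℕ-fromℕ< (s≤s j≤N))
    (values≡ (fromℕ< (s≤s i≤N)) (fromℕ< (s≤s j≤N)))
  where
  values≡ : ∀ i j → value c (toℕ i) (toℕ j) ≡ value c′ (toℕ i) (toℕ j)
  values≡ i j = +-injective (trans (sym (entry-toArray c i j))
    (trans (cong (λ a → entry a i j) e) (entry-toArray c′ i j)))

-- Codes from obeying arrays

-- Extends an array to all natural indices, the form that `Grid` takes.
clamp : ∀ N → ℕ → Fin (suc N)
clamp N i = fromℕ< (s≤s (m⊓n≤n i N))

toℕ-clamp : ∀ {N i} → i ≤ N → toℕ (clamp N i) ≡ i
toℕ-clamp {N} {i} i≤N = trans (toℕ-fromℕ< (s≤s (m⊓n≤n i N))) (m≤n⇒m⊓n≡m i≤N)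

clamp-toℕ : ∀ {N} (i : Fin (suc N)) → clamp N (toℕ i) ≡ i
clamp-toℕ i = toℕ-injective (toℕ-clamp (toℕ≤pred[n] i))

module _ {N} {a : Array (suc N) (suc N)} (o : Obeys 1 (suc N) (suc N) a) where
  open Obeys o

  private
    z : ℕ → ℕ → ℤ
    z i j = entry a (clamp N i) (clamp N j)

    next : ∀ {i} → i < N → pos (clamp N (suc i)) ≡ suc (pos (clamp N i))
    next i<N = cong suc (trans (toℕ-clamp i<N) (cong suc (sym (toℕ-clamp (<⇒≤ i<N)))))

    -- From 0 at the origin, walking along the first row and then down a column only ever adds 0 or
    -- 1, so no entry is negative.
    natural : ∀ {i j} → i ≤ N → j ≤ N → z i j ≡ + ∣ z i j ∣
    natural i≤N j≤N with go _ _ i≤N j≤N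
      where
      up : ∀ {x y} → EqualOrOneMore x y → (∃ λ m → y ≡ + m) → ∃ λ m → x ≡ + m
      up (inj₁ e) (m , refl) = m , e
      up (inj₂ e) (m , refl) = m + 1 , e

      go : ∀ i j → i ≤ N → j ≤ N → ∃ λ m → z i j ≡ + m
      go zero    zero    _   _   = 0 , first _ _ refl refl
      go zero    (suc j) _   j<N = up (left _ _ _ (next j<N)) (go zero j z≤n (<⇒≤ j<N))
      go (suc i) j       i<N j≤N = up (above _ _ _ (next i<N)) (go i j (<⇒≤ i<N) j≤N)
    ... | m , e = trans e (cong (λ x → + ∣ x ∣) (sym e))

    step : ∀ {i j i′ j′} → i ≤ N → j ≤ N → i′ ≤ N → j′ ≤ N →
           EqualOrOneMore (z i j) (z i′ j′) → Next ∣ z i j ∣ ∣ z i′ j′ ∣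
    step i≤N j≤N i′≤N j′≤N s =
      EqualOrOneMore⇒Next (subst₂ EqualOrOneMore (natural i≤N j≤N) (natural i′≤N j′≤N) s)

  obeys⇒Grid : Grid N (λ i j → ∣ z i j ∣)
  obeys⇒Grid = record
    { origin = cong ∣_∣ (first _ _ refl refl)
    ; final  = corner-injective (trans (sym (natural ≤-refl ≤-refl))
                 (last _ _ (cong suc (toℕ-clamp ≤-refl)) (cong suc (toℕ-clamp ≤-refl))))
    ; above  = λ i<N j≤N → step i<N j≤N (<⇒≤ i<N) j≤N (above _ _ _ (next i<N))
    ; left   = λ i≤N j<N → step i≤N j<N i≤N (<⇒≤ j<N) (left _ _ _ (next j<N))
    ; diag   = λ i<N j<N → step i<N j<N (<⇒≤ i<N) (<⇒≤ j<N) (aboveLeft _ _ _ _ (next i<N) (next j<N))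
    ; lower  = λ i≤N j≤N → Within⇒lower (subst₂ (Within 1)
                 (cong₂ (λ k l → + (k ⊔ l)) (toℕ-clamp i≤N) (toℕ-clamp j≤N))
                 (natural i≤N j≤N) (within _ _))
    }

  toArray-complete : ∃ λ c → a ≡ toArray c
  toArray-complete with value-complete obeys⇒Grid
  ... | c , agree = c , array-ext λ i j → begin
    entry a i j                       ≡⟨ cong₂ (entry a) (clamp-toℕ i) (clamp-toℕ j) ⟨
    z (toℕ i) (toℕ j)                 ≡⟨ natural (toℕ≤pred[n] i) (toℕ≤pred[n] j) ⟩
    + ∣ z (toℕ i) (toℕ j) ∣           ≡⟨ cong +_ (agree (toℕ≤pred[n] i) (toℕ≤pred[n] j)) ⟩
    + value c (toℕ i) (toℕ j)         ≡⟨ entry-toArray c i j ⟨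
    entry (toArray c) i j             ∎
    where open ≡-Reasoning

-- Counting codes

bits : List (Bool × Bool)
bits = (true , true) ∷ (true , false) ∷ (false , true) ∷ (false , false) ∷ []

codes : ∀ N → List (Code N)
codes zero    = []
codes (suc N) = flat ∷ cartesianProductWith grow bits (codes N)

∈-codes : ∀ {N} (c : Code N) → c ∈ codes N
∈-codes flat        = here refl
∈-codes (grow pq c) = there (∈-cartesianProductWith⁺ grow (∈-bits pq) (∈-codes c))
  where
  ∈-bits : ∀ pq → pq ∈ bits
  ∈-bits (true  , true ) = here refl
  ∈-bits (true  , false) = there (here refl)
  ∈-bits (false , true ) = there (there (here refl))
  ∈-bits (false , false) = there (there (there (here refl)))

codes-unique : ∀ N → Unique (codes N)
codes-unique zero    = []
codes-unique (suc N) =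
  All.tabulate flat∉ ∷
  Uniqueₚ.cartesianProductWith⁺ grow (λ { refl → refl , refl }) bits-unique (codes-unique N)
  where
  bits-unique : Unique bits
  bits-unique = ((λ ()) All.∷ (λ ()) All.∷ (λ ()) All.∷ All.[]) ∷ ((λ ()) All.∷ (λ ()) All.∷ All.[])
              ∷ ((λ ()) All.∷ All.[]) ∷ All.[] ∷ []

  flat∉ : ∀ {c} → c ∈ cartesianProductWith grow bits (codes N) → flat ≢ c
  flat∉ c∈ refl with () ← ∈-cartesianProductWith⁻ grow bits (codes N) c∈

length-cartesianProductWith : ∀ {A B C : Set} (f : A → B → C) xs ys →
  length (cartesianProductWith f xs ys) ≡ length xs ℕ.* length ys
length-cartesianProductWith f []       ys = refl
length-cartesianProductWith f (x ∷ xs) ys = trans (length-++ (List.map (f x) ys))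
  (cong₂ _+_ (length-map (f x) ys) (length-cartesianProductWith f xs ys))

-- Tripling and adding 1 turns the recurrence `l ↦ 1 + 4 l` into multiplication by 4.
3*length-codes : ∀ N → suc (3 ℕ.* length (codes N)) ≡ 4 ^ N
3*length-codes zero    = refl
3*length-codes (suc N) = begin
  suc (3 ℕ.* length (codes (suc N)))
    ≡⟨ cong (λ l → suc (3 ℕ.* suc l)) (length-cartesianProductWith grow bits (codes N)) ⟩
  suc (3 ℕ.* suc (4 ℕ.* l))  ≡⟨ rearrange l ⟩
  4 ℕ.* suc (3 ℕ.* l)        ≡⟨ cong (4 ℕ.*_) (3*length-codes N) ⟩
  4 ℕ.* 4 ^ N              ∎
  where
  open ≡-Reasoning
  l = length (codes N)
  rearrange : ∀ l → suc (3 ℕ.* suc (4 ℕ.* l)) ≡ 4 ℕ.* suc (3 ℕ.* l)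
  rearrange = ℕ-Solver.solve-∀

-- Without duplicates, equality as sets is equality as bags, hence a permutation.
length-unique : ∀ {A : Set} {xs ys : List A} → Unique xs → Unique ys →
                (∀ {x} → x ∈ xs → x ∈ ys) → (∀ {x} → x ∈ ys → x ∈ xs) → length xs ≡ length ys
length-unique u v f g = ↭-length (∼bag⇒↭ (unique∧set⇒bag u v (mk⇔ f g)))

H≡length-codes : ∀ N → H 1 (suc N) (suc N) ≡ length (codes N)
H≡length-codes N = trans
  (length-unique {xs = obeying 1 n n} {ys = List.map toArray (codes N)}
    (obeying-unique 1 n n) (Uniqueₚ.map⁺ toArray-injective (codes-unique N))
    (λ {a} a∈ → obeys⇒∈ (obeying-sound 1 n n a a∈))
    (λ {a} a∈ → obeying-complete 1 n n a (∈⇒obeys a∈)))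
  (length-map toArray (codes N))
  where
  n = suc N

  obeys⇒∈ : ∀ {a} → Obeys 1 n n a → a ∈ List.map toArray (codes N)
  obeys⇒∈ o with toArray-complete o
  ... | c , refl = ∈-map⁺ toArray (∈-codes c)

  ∈⇒obeys : ∀ {a} → a ∈ List.map toArray (codes N) → Obeys 1 n n a
  ∈⇒obeys a∈ with ∈-map⁻ toArray a∈
  ... | c , _ , refl = toArray-obeys c

-- The closed form over the rationals

-- Among unnormalised rationals the equation is a cross-multiplied polynomial identity over the
-- integers, free of gcds.
third : ∀ h → (+ h) / 1 ≡ (+ 1 / 3) * ((+ suc (3 ℕ.* h)) / 1 - 1ℚ)
third h = ℚₚ.toℚᵘ-injective (begin
  toℚᵘ (fromℚᵘ h/1)
    ≈⟨ ℚₚ.toℚᵘ-fromℚᵘ h/1 ⟩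
  h/1
    ≈⟨ *≡* (numerators (cong (ℤ._+_ (+ 1)) (ℤₚ.pos-* 3 h))) ⟩
  1/3 ℚᵘ.* (t/1 ℚᵘ.- 1ℚᵘ)
    ≈⟨ ℚᵘₚ.*-cong (ℚₚ.toℚᵘ-fromℚᵘ 1/3) (ℚᵘₚ.+-congˡ (ℚᵘ.- 1ℚᵘ) (ℚₚ.toℚᵘ-fromℚᵘ t/1)) ⟨
  toℚᵘ (fromℚᵘ 1/3) ℚᵘ.* (toℚᵘ (fromℚᵘ t/1) ℚᵘ.- 1ℚᵘ)
    ≈⟨ ℚᵘₚ.*-congˡ {toℚᵘ (fromℚᵘ 1/3)} (ℚₚ.toℚᵘ-homo-+ (fromℚᵘ t/1) (ℚ.- 1ℚ)) ⟨
  toℚᵘ (fromℚᵘ 1/3) ℚᵘ.* toℚᵘ (fromℚᵘ t/1 - 1ℚ)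
    ≈⟨ ℚₚ.toℚᵘ-homo-* (fromℚᵘ 1/3) (fromℚᵘ t/1 - 1ℚ) ⟨
  toℚᵘ (fromℚᵘ 1/3 * (fromℚᵘ t/1 - 1ℚ))
    ∎)
  where
  open ℚᵘₚ.≃-Reasoning
  h/1 = mkℚᵘ (+ h) 0
  1/3 = mkℚᵘ (+ 1) 2
  t/1 = mkℚᵘ (+ suc (3 ℕ.* h)) 0

  ring : ∀ x → x ℤ.* + 3 ≡ + 1 ℤ.* ((+ 1 ℤ.+ + 3 ℤ.* x) ℤ.* + 1 ℤ.+ ℤ.- (+ 1) ℤ.* + 1) ℤ.* + 1
  ring = ℤ-Solver.solve-∀

  -- Abstracting the numerator as `t` lets it be replaced by a polynomial in `+ h`, to which `ring`
  -- applies.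
  numerators : ∀ {t} → t ≡ + 1 ℤ.+ + 3 ℤ.* + h →
               + h ℤ.* + 3 ≡ + 1 ℤ.* (t ℤ.* + 1 ℤ.+ ℤ.- (+ 1) ℤ.* + 1) ℤ.* + 1
  numerators refl = ring (+ h)

theorem1 : (n : ℕ) → n ≥ 1 →
    (+ H 1 n n) / 1 ≡ (+ 1 / 3) * ((+ (4 ^ (n ∸ 1))) / 1 - 1ℚ)
theorem1 (suc N) _ = begin
  (+ H 1 (suc N) (suc N)) / 1                    ≡⟨ cong (λ h → (+ h) / 1) (H≡length-codes N) ⟩
  (+ l) / 1                                      ≡⟨ third l ⟩
  (+ 1 / 3) * ((+ suc (3 ℕ.* l)) / 1 - 1ℚ)       ≡⟨ cong (λ x → (+ 1 / 3) * ((+ x) / 1 - 1ℚ)) (3*length-codes N) ⟩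
  (+ 1 / 3) * ((+ (4 ^ N)) / 1 - 1ℚ)             ∎
  where
  open ≡-Reasoning
  l = length (codes N)
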